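{- The base-$x$ digit ordering $<$ on $\mathbb{Z}[x]$ makes $\mathbb{Z}[x]$ an ordered integral domain. In particular, for $f,g\in\mathbb{Z}[x]$, $f>g$ if and only if $f-g$ has positive leading coefficient. If $f>g$, then (i) $f+h>g+h$ for all $h\in\mathbb{Z}[x]$, and (ii) $fh>gh$ for all $h\in\mathbb{Z}[x]$ with $h>0$.
   Context: A polynomial in $\mathbb{Z}[x]$ is called positive if its leading coefficient is positive. The polynomial alphabet is the set of digits $\{0,1,2,\dots\}\cup\{x-1,x-2,\dots\}$, linearly ordered by $0<1<\cdots<n<\cdots<x-n<\cdots<x-2<x-1$. Every positive $f\in\mathbb{Z}[x]$ has a unique base-$x$ representation $f(x)=\sum_{i=0}^m b_i(x)x^i$ with all $b_i(x)$ in the alphabet and $b_m(x)\neq0$; it has $m+1$ digits. The base-$x$ digit ordering on $\mathbb{Z}[x]$ is defined as follows: positive polynomials are compared first by number of digits (more digits is larger), and, when these are equal, lexicographically by digits starting from the leading digit $b_m(x)$; $0$ is smaller than every positive polynomial; every $f$ with $-f$ positive is smaller than $0$ and than every positive polynomial; and if $-f,-g$ are positive then $f<g$ iff $-g<-f$. -}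

module Defs where

open import Algebra.Core using (Op₁; Op₂)
open import Algebra.Structures using (IsCommutativeRing)
open import Data.Integer.Base as ℤ using (ℤ; +_; -[1+_]; 0ℤ; 1ℤ)
open import Data.List.Base using (List; []; _∷_; _++_; length; map; replicate)
open import Data.List.Relation.Binary.Lex.Strict using (Lex-<)
open import Data.Nat.Base as ℕ using (ℕ; zero; suc)
open import Data.Product.Base using (∃-syntax; _×_)
open import Data.Sum.Base using (_⊎_)
open import Level using (0ℓ; _⊔_)
open import Relation.Binary.Core using (Rel)
open import Relation.Binary.PropositionalEquality.Core using (_≡_; _≢_)
open import Relation.Binary.Structures using (IsStrictTotalOrder)
open import Relation.Nullary.Negation.Core using (¬_)

------------------------------------------------------------------------
-- Ordered integral domains

module _ {a ℓ} {A : Set a} (_≈_ : Rel A ℓ) where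

  record IsIntegralDomain (_+_ _*_ : Op₂ A) (-_ : Op₁ A) (0# 1# : A)
                          : Set (a ⊔ ℓ) where
    field
      isCommutativeRing : IsCommutativeRing _≈_ _+_ _*_ -_ 0# 1#
      1≉0               : ¬ (1# ≈ 0#)
      noZeroDivisors    : ∀ x y → (x * y) ≈ 0# → (x ≈ 0#) ⊎ (y ≈ 0#)

  record IsOrderedIntegralDomain {ℓ′} (_<_ : Rel A ℓ′)
                                 (_+_ _*_ : Op₂ A) (-_ : Op₁ A) (0# 1# : A)
                                 : Set (a ⊔ ℓ ⊔ ℓ′) where
    field
      isIntegralDomain   : IsIntegralDomain _+_ _*_ -_ 0# 1#
      isStrictTotalOrder : IsStrictTotalOrder _≈_ _<_
      +-monoˡ-<          : ∀ x y z → x < y → (x + z) < (y + z)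
      *-positive         : ∀ x y → 0# < x → 0# < y → 0# < (x * y)

------------------------------------------------------------------------
-- The ring ℤ[x]

-- Coefficients, constant term first.  Trailing zeros are allowed, so
-- equality of polynomials is _≈_ and not _≡_.
Poly : Set
Poly = List ℤ

coeff : Poly → ℕ → ℤ
coeff []      _       = 0ℤ
coeff (a ∷ f) zero    = a
coeff (a ∷ f) (suc i) = coeff f i

infix  8 -_
infixl 7 _*_
infixl 6 _+_ _-_
infix  4 _≈_ _<_ _>_ _≺_ _<ᵈ_

record _≈_ (f g : Poly) : Set where
  constructor mk≈
  field
    coeff-≡ : ∀ i → coeff f i ≡ coeff g i

0ᵖ 1ᵖ : Poly
0ᵖ = []
1ᵖ = 1ℤ ∷ []

_+_ : Op₂ Poly
[]      + g       = g
(a ∷ f) + []      = a ∷ f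
(a ∷ f) + (b ∷ g) = (a ℤ.+ b) ∷ (f + g)

-_ : Op₁ Poly
- f = map (λ a → ℤ.- a) f

_-_ : Op₂ Poly
f - g = f + (- g)

_*_ : Op₂ Poly
[]      * g = []
(a ∷ f) * g = map (a ℤ.*_) g + (0ℤ ∷ (f * g))

x^_·_ : ℕ → Poly → Poly
x^ k · f = replicate k 0ℤ ++ f

IsLeadingCoeff : Poly → ℤ → Set
IsLeadingCoeff f c =
  ∃[ n ] coeff f n ≡ c × c ≢ 0ℤ × (∀ i → n ℕ.< i → coeff f i ≡ 0ℤ)

Positive : Poly → Set
Positive f = ∃[ c ] IsLeadingCoeff f c × 0ℤ ℤ.< c

------------------------------------------------------------------------
-- Base-x representations

-- num n is the digit n, and x-suc n is the digit x - (n + 1).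
data Digit : Set where
  num   : ℕ → Digit
  x-suc : ℕ → Digit

digitPoly : Digit → Poly
digitPoly (num n)   = + n ∷ []
digitPoly (x-suc n) = -[1+ n ] ∷ 1ℤ ∷ []

data _<ᵈ_ : Rel Digit 0ℓ where
  num<num     : ∀ {m n} → m ℕ.< n → num m <ᵈ num n
  num<x-suc   : ∀ {m n} → num m <ᵈ x-suc n
  x-suc<x-suc : ∀ {m n} → n ℕ.< m → x-suc m <ᵈ x-suc n

-- Digit strings are written most significant digit first.
value : List Digit → Poly
value []       = 0ᵖ
value (b ∷ bs) = x^ length bs · digitPoly b + value bs

data BaseXRep (f : Poly) : List Digit → Set where
  rep : ∀ {b bs} → b ≢ num 0 → f ≈ value (b ∷ bs) → BaseXRep f (b ∷ bs)

data _≺_ (bs cs : List Digit) : Set where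
  fewer : length bs ℕ.< length cs → bs ≺ cs
  lex   : length bs ≡ length cs → Lex-< _≡_ _<ᵈ_ bs cs → bs ≺ cs

------------------------------------------------------------------------
-- The base-x digit ordering

data _<_ : Rel Poly 0ℓ where
  pos<pos   : ∀ {f g bs cs} → Positive f → Positive g →
              BaseXRep f bs → BaseXRep g cs → bs ≺ cs → f < g
  zero<pos  : ∀ {f g} → f ≈ 0ᵖ → Positive g → f < g
  neg<zero  : ∀ {f g} → Positive (- f) → g ≈ 0ᵖ → f < g
  neg<pos   : ∀ {f g} → Positive (- f) → Positive g → f < g
  neg<neg   : ∀ {f g} → Positive (- f) → Positive (- g) → - g < - f → f < g

_>_ : Rel Poly 0ℓ
f > g = g < f

{-# OPTIONS --safe #-}

-- The base-x digit ordering coincides with f < g ⇔ g - f positive, for which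
-- the ordered ring axioms are immediate.  The value of a string of k digits is
-- nonnegative and less than x^k, and two distinct digits differ by at least 1.
-- So at the first difference between two strings of equal length the difference
-- of the digits outweighs everything that follows, and a longer string beats a
-- shorter one.  Since representations exist and digit strings are totally
-- ordered, the converse implication follows.

module Submission where

open import Defs
open import Algebra.Structures using (IsCommutativeRing)
open import Data.Empty using (⊥-elim)
open import Data.Integer.Base as ℤ
  using (ℤ; +_; -[1+_]; 0ℤ; 1ℤ; -1ℤ; +<+; +≤+)
import Data.Integer.Properties as ℤ
import Data.Integer.Tactic.RingSolver as ℤSolver
open import Data.List.Base using ([]; _∷_; _++_; map; length)
open import Data.List.Properties using (length-++)
open import Data.List.Relation.Binary.Lex.Strict
  using (Lex-<; this; next; <-compare)
open import Data.List.Relation.Binary.Pointwise using (Pointwise-≡⇒≡)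
open import Data.Maybe.Base using (Maybe; just; nothing)
open import Data.Nat.Base as ℕ
  using (ℕ; zero; suc; _≤′_; ≤′-reflexive; ≤′-step; z≤n; s≤s; z<s; s<s)
import Data.Nat.Properties as ℕ
open import Data.Product.Base using (_×_; _,_; ∃-syntax)
open import Data.Sum.Base using (_⊎_; inj₁; inj₂)
open import Function.Base using (_∘_)
open import Function.Bundles using (_⇔_; mk⇔)
open import Level using (0ℓ)
open import Relation.Binary.Bundles using (Setoid)
open import Relation.Binary.Definitions
  using (Trichotomous; tri<; tri≈; tri>)
open import Relation.Binary.PropositionalEquality
  using (_≡_; _≢_; refl; sym; trans; cong; cong₂; subst)
import Relation.Binary.Reasoning.Setoid as SetoidReasoning
open import Relation.Binary.Structures
  using (IsEquivalence; IsStrictTotalOrder)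
open import Relation.Nullary.Decidable.Core using (yes; no)
open import Relation.Nullary.Negation.Core using (¬_)
open import Tactic.RingSolver using (solve-∀)
open import Tactic.RingSolver.Core.AlmostCommutativeRing
  using (AlmostCommutativeRing; fromCommutativeRing)

open _≈_

-- The commutative ring ℤ[x]

≈-isEquivalence : IsEquivalence _≈_
≈-isEquivalence = record
  { refl  = mk≈ λ _ → refl
  ; sym   = λ p → mk≈ λ i → sym (coeff-≡ p i)
  ; trans = λ p q → mk≈ λ i → trans (coeff-≡ p i) (coeff-≡ q i)
  }

≈-setoid : Setoid 0ℓ 0ℓ
≈-setoid = record { isEquivalence = ≈-isEquivalence }

open IsEquivalence ≈-isEquivalence
  renaming (refl to ≈-refl; sym to ≈-sym; trans to ≈-trans)
open SetoidReasoning ≈-setoid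

∷-cong : ∀ {a b f g} → a ≡ b → f ≈ g → a ∷ f ≈ b ∷ g
∷-cong a≡b f≈g = mk≈ λ { zero → a≡b ; (suc i) → coeff-≡ f≈g i }

0∷0≈0 : 0ℤ ∷ 0ᵖ ≈ 0ᵖ
0∷0≈0 = mk≈ λ { zero → refl ; (suc _) → refl }

coeff-+ : ∀ f g i → coeff (f + g) i ≡ coeff f i ℤ.+ coeff g i
coeff-+ []      g       i       = sym (ℤ.+-identityˡ _)
coeff-+ (a ∷ f) []      i       = sym (ℤ.+-identityʳ _)
coeff-+ (a ∷ f) (b ∷ g) zero    = refl
coeff-+ (a ∷ f) (b ∷ g) (suc i) = coeff-+ f g i

coeff-neg : ∀ f i → coeff (- f) i ≡ ℤ.- coeff f i
coeff-neg []      i       = refl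
coeff-neg (a ∷ f) zero    = refl
coeff-neg (a ∷ f) (suc i) = coeff-neg f i

coeff-scale : ∀ a f i → coeff (map (a ℤ.*_) f) i ≡ a ℤ.* coeff f i
coeff-scale a []      i       = sym (ℤ.*-zeroʳ a)
coeff-scale a (b ∷ f) zero    = refl
coeff-scale a (b ∷ f) (suc i) = coeff-scale a f i

-- Equal polynomials may be lists of different lengths, so the congruences go through coefficients
-- and not through recursion on the lists.
+-cong : ∀ {f f′ g g′} → f ≈ f′ → g ≈ g′ → f + g ≈ f′ + g′
+-cong {f} {f′} {g} {g′} p q = mk≈ λ i →
  trans (coeff-+ f g i)
    (trans (cong₂ ℤ._+_ (coeff-≡ p i) (coeff-≡ q i)) (sym (coeff-+ f′ g′ i)))

+-congˡ : ∀ f {g g′} → g ≈ g′ → f + g ≈ f + g′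
+-congˡ f = +-cong (≈-refl {f})

+-congʳ : ∀ g {f f′} → f ≈ f′ → f + g ≈ f′ + g
+-congʳ g p = +-cong p (≈-refl {g})

neg-cong : ∀ {f g} → f ≈ g → - f ≈ - g
neg-cong {f} {g} p = mk≈ λ i →
  trans (coeff-neg f i) (trans (cong ℤ.-_ (coeff-≡ p i)) (sym (coeff-neg g i)))

+-comm : ∀ f g → f + g ≈ g + f
+-comm f g = mk≈ λ i →
  trans (coeff-+ f g i) (trans (ℤ.+-comm (coeff f i) _) (sym (coeff-+ g f i)))

+-assoc : ∀ f g h → (f + g) + h ≈ f + (g + h)
+-assoc []      g       h       = ≈-refl
+-assoc (a ∷ f) []      h       = ≈-refl
+-assoc (a ∷ f) (b ∷ g) []      = ≈-refl
+-assoc (a ∷ f) (b ∷ g) (c ∷ h) = ∷-cong (ℤ.+-assoc a b c) (+-assoc f g h)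

+-identityʳ : ∀ f → f + 0ᵖ ≈ f
+-identityʳ f = +-comm f 0ᵖ

+-inverseˡ : ∀ f → - f + f ≈ 0ᵖ
+-inverseˡ []      = ≈-refl
+-inverseˡ (a ∷ f) = ≈-trans (∷-cong (ℤ.+-inverseˡ a) (+-inverseˡ f)) 0∷0≈0

+-inverseʳ : ∀ f → f + - f ≈ 0ᵖ
+-inverseʳ f = ≈-trans (+-comm f (- f)) (+-inverseˡ f)

+-middle : ∀ f g h → f + (g + h) ≈ g + (f + h)
+-middle f g h = begin
  f + (g + h) ≈⟨ +-assoc f g h ⟨
  (f + g) + h ≈⟨ +-congʳ h (+-comm f g) ⟩
  (g + f) + h ≈⟨ +-assoc g f h ⟩
  g + (f + h) ∎

+-interchange : ∀ f g h k → (f + g) + (h + k) ≈ (f + h) + (g + k)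
+-interchange f g h k = begin
  (f + g) + (h + k) ≈⟨ +-assoc f g (h + k) ⟩
  f + (g + (h + k)) ≈⟨ +-congˡ f (+-middle g h k) ⟩
  f + (h + (g + k)) ≈⟨ +-assoc f h (g + k) ⟨
  (f + h) + (g + k) ∎

scale-cong : ∀ a {f g} → f ≈ g → map (a ℤ.*_) f ≈ map (a ℤ.*_) g
scale-cong a {f} {g} p = mk≈ λ i →
  trans (coeff-scale a f i)
    (trans (cong (a ℤ.*_) (coeff-≡ p i)) (sym (coeff-scale a g i)))

scale-+ : ∀ a f g → map (a ℤ.*_) (f + g) ≈ map (a ℤ.*_) f + map (a ℤ.*_) g
scale-+ a []      g       = ≈-refl
scale-+ a (b ∷ f) []      = ≈-refl
scale-+ a (b ∷ f) (c ∷ g) = ∷-cong (ℤ.*-distribˡ-+ a b c) (scale-+ a f g)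

scale-scale : ∀ a b f → map ((a ℤ.* b) ℤ.*_) f ≈ map (a ℤ.*_) (map (b ℤ.*_) f)
scale-scale a b []      = ≈-refl
scale-scale a b (c ∷ f) = ∷-cong (ℤ.*-assoc a b c) (scale-scale a b f)

scale-one : ∀ f → map (1ℤ ℤ.*_) f ≈ f
scale-one []      = ≈-refl
scale-one (a ∷ f) = ∷-cong (ℤ.*-identityˡ a) (scale-one f)

scale-zero : ∀ f → map (0ℤ ℤ.*_) f ≈ 0ᵖ
scale-zero []      = ≈-refl
scale-zero (a ∷ f) = ≈-trans (∷-cong refl (scale-zero f)) 0∷0≈0

*-zeroʳ : ∀ f → f * 0ᵖ ≈ 0ᵖ
*-zeroʳ []      = ≈-refl
*-zeroʳ (a ∷ f) = ≈-trans (∷-cong refl (*-zeroʳ f)) 0∷0≈0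

shift-* : ∀ f g → (0ℤ ∷ f) * g ≈ 0ℤ ∷ (f * g)
shift-* f g = +-congʳ (0ℤ ∷ (f * g)) (scale-zero g)

scale-* : ∀ a f g → map (a ℤ.*_) f * g ≈ map (a ℤ.*_) (f * g)
scale-* a []      g = ≈-refl
scale-* a (b ∷ f) g = begin
  map ((a ℤ.* b) ℤ.*_) g + (0ℤ ∷ map (a ℤ.*_) f * g)
    ≈⟨ +-cong (scale-scale a b g)
              (∷-cong (sym (ℤ.*-zeroʳ a)) (scale-* a f g)) ⟩
  map (a ℤ.*_) (map (b ℤ.*_) g) + map (a ℤ.*_) (0ℤ ∷ f * g)
    ≈⟨ scale-+ a (map (b ℤ.*_) g) (0ℤ ∷ f * g) ⟨
  map (a ℤ.*_) (map (b ℤ.*_) g + (0ℤ ∷ f * g)) ∎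

*-congˡ : ∀ f {g g′} → g ≈ g′ → f * g ≈ f * g′
*-congˡ []      p = ≈-refl
*-congˡ (a ∷ f) p = +-cong (scale-cong a p) (∷-cong refl (*-congˡ f p))

-- Mirrors the defining clause of `_*_`, which recurses on the left factor only; with it `*-comm` is
-- a plain induction.
*-∷ : ∀ f b g → f * (b ∷ g) ≈ map (b ℤ.*_) f + (0ℤ ∷ f * g)
*-∷ []      b g = ≈-sym 0∷0≈0
*-∷ (a ∷ f) b g = ∷-cong (cong (ℤ._+ 0ℤ) (ℤ.*-comm a b)) (begin
  map (a ℤ.*_) g + f * (b ∷ g)
    ≈⟨ +-congˡ (map (a ℤ.*_) g) (*-∷ f b g) ⟩
  map (a ℤ.*_) g + (map (b ℤ.*_) f + (0ℤ ∷ f * g))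
    ≈⟨ +-middle (map (a ℤ.*_) g) (map (b ℤ.*_) f) (0ℤ ∷ f * g) ⟩
  map (b ℤ.*_) f + (map (a ℤ.*_) g + (0ℤ ∷ f * g)) ∎)

*-comm : ∀ f g → f * g ≈ g * f
*-comm []      g = ≈-sym (*-zeroʳ g)
*-comm (a ∷ f) g = begin
  map (a ℤ.*_) g + (0ℤ ∷ f * g)
    ≈⟨ +-congˡ (map (a ℤ.*_) g) (∷-cong refl (*-comm f g)) ⟩
  map (a ℤ.*_) g + (0ℤ ∷ g * f)
    ≈⟨ *-∷ g a f ⟨
  g * (a ∷ f) ∎

-- Recursion on `f` gives congruence in the right factor; commutativity carries it over to the left
-- one.
*-cong : ∀ {f f′ g g′} → f ≈ f′ → g ≈ g′ → f * g ≈ f′ * g′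
*-cong {f} {f′} {g} {g′} p q = begin
  f * g   ≈⟨ *-congˡ f q ⟩
  f * g′  ≈⟨ *-comm f g′ ⟩
  g′ * f  ≈⟨ *-congˡ g′ p ⟩
  g′ * f′ ≈⟨ *-comm g′ f′ ⟩
  f′ * g′ ∎

*-distribˡ-+ : ∀ f g h → f * (g + h) ≈ f * g + f * h
*-distribˡ-+ []      g h = ≈-refl
*-distribˡ-+ (a ∷ f) g h = begin
  map (a ℤ.*_) (g + h) + (0ℤ ∷ f * (g + h))
    ≈⟨ +-cong (scale-+ a g h) (∷-cong refl (*-distribˡ-+ f g h)) ⟩
  (map (a ℤ.*_) g + map (a ℤ.*_) h) + ((0ℤ ∷ f * g) + (0ℤ ∷ f * h))
    ≈⟨ +-interchange (map (a ℤ.*_) g) (map (a ℤ.*_) h) (0ℤ ∷ f * g) (0ℤ ∷ f * h) ⟩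
  (a ∷ f) * g + (a ∷ f) * h ∎

*-distribʳ-+ : ∀ h f g → (f + g) * h ≈ f * h + g * h
*-distribʳ-+ h f g = begin
  (f + g) * h   ≈⟨ *-comm (f + g) h ⟩
  h * (f + g)   ≈⟨ *-distribˡ-+ h f g ⟩
  h * f + h * g ≈⟨ +-cong (*-comm h f) (*-comm h g) ⟩
  f * h + g * h ∎

*-assoc : ∀ f g h → (f * g) * h ≈ f * (g * h)
*-assoc []      g h = ≈-refl
*-assoc (a ∷ f) g h = begin
  (map (a ℤ.*_) g + (0ℤ ∷ f * g)) * h
    ≈⟨ *-distribʳ-+ h (map (a ℤ.*_) g) (0ℤ ∷ f * g) ⟩
  map (a ℤ.*_) g * h + (0ℤ ∷ f * g) * h
    ≈⟨ +-cong (scale-* a g h) (shift-* (f * g) h) ⟩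
  map (a ℤ.*_) (g * h) + (0ℤ ∷ (f * g) * h)
    ≈⟨ +-congˡ (map (a ℤ.*_) (g * h)) (∷-cong refl (*-assoc f g h)) ⟩
  (a ∷ f) * (g * h) ∎

*-identityˡ : ∀ f → 1ᵖ * f ≈ f
*-identityˡ f = begin
  map (1ℤ ℤ.*_) f + (0ℤ ∷ 0ᵖ) ≈⟨ +-cong (scale-one f) 0∷0≈0 ⟩
  f + 0ᵖ                      ≈⟨ +-identityʳ f ⟩
  f                           ∎

*-identityʳ : ∀ f → f * 1ᵖ ≈ f
*-identityʳ f = ≈-trans (*-comm f 1ᵖ) (*-identityˡ f)

+-*-isCommutativeRing : IsCommutativeRing _≈_ _+_ _*_ -_ 0ᵖ 1ᵖ
+-*-isCommutativeRing = record
  { isRing = record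
    { +-isAbelianGroup = record
      { isGroup = record
        { isMonoid = record
          { isSemigroup = record
            { isMagma = record
              { isEquivalence = ≈-isEquivalence
              ; ∙-cong        = +-cong
              }
            ; assoc = +-assoc
            }
          ; identity = (λ _ → ≈-refl) , +-identityʳ
          }
        ; inverse = +-inverseˡ , +-inverseʳ
        ; ⁻¹-cong = neg-cong
        }
      ; comm = +-comm
      }
    ; *-cong     = *-cong
    ; *-assoc    = *-assoc
    ; *-identity = *-identityˡ , *-identityʳ
    ; distrib    = *-distribˡ-+ , *-distribʳ-+
    }
  ; *-comm = *-comm
  }

-- The solver cancels terms only when it can recognise zero coefficients.
0≟_ : ∀ f → Maybe (0ᵖ ≈ f)
0≟ []      = just ≈-refl
0≟ (a ∷ f) with a ℤ.≟ 0ℤ | 0≟ f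
... | yes refl | just 0≈f = just (≈-trans (≈-sym 0∷0≈0) (∷-cong refl 0≈f))
... | _        | _        = nothing

+-*-ring : AlmostCommutativeRing 0ℓ 0ℓ
+-*-ring = fromCommutativeRing
  (record { isCommutativeRing = +-*-isCommutativeRing }) 0≟_

-- Leading coefficients and positivity

-- c may be zero here, so that n only bounds the degree.
record TopCoeff (f : Poly) (n : ℕ) (c : ℤ) : Set where
  constructor mkTop
  field
    coeff≡c : coeff f n ≡ c
    above≡0 : ∀ i → n ℕ.< i → coeff f i ≡ 0ℤ

open TopCoeff

topCoeff-+ : ∀ {f g n c d} → TopCoeff f n c → TopCoeff g n d →
             TopCoeff (f + g) n (c ℤ.+ d)
topCoeff-+ {f} {g} {n} p q = mkTop
  (trans (coeff-+ f g n) (cong₂ ℤ._+_ (coeff≡c p) (coeff≡c q)))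
  (λ i n<i → trans (coeff-+ f g i) (cong₂ ℤ._+_ (above≡0 p i n<i) (above≡0 q i n<i)))

-- Brings two summands of different degrees to a common bound, as `topCoeff-+` requires.
topCoeff-raise : ∀ {f m n c} → m ℕ.< n → TopCoeff f m c → TopCoeff f n 0ℤ
topCoeff-raise m<n p =
  mkTop (above≡0 p _ m<n) (λ i n<i → above≡0 p i (ℕ.<-trans m<n n<i))

topCoeff-scale : ∀ a {f n c} → TopCoeff f n c →
                 TopCoeff (map (a ℤ.*_) f) n (a ℤ.* c)
topCoeff-scale a {f} {n} p = mkTop
  (trans (coeff-scale a f n) (cong (a ℤ.*_) (coeff≡c p)))
  (λ i n<i → trans (coeff-scale a f i)
                   (trans (cong (a ℤ.*_) (above≡0 p i n<i)) (ℤ.*-zeroʳ a)))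

topCoeff-∷ : ∀ a {f n c} → TopCoeff f n c → TopCoeff (a ∷ f) (suc n) c
topCoeff-∷ a p = mkTop (coeff≡c p) (λ { (suc i) (s<s n<i) → above≡0 p i n<i })

topCoeff-∷⁻¹ : ∀ {a f n c} → TopCoeff (a ∷ f) (suc n) c → TopCoeff f n c
topCoeff-∷⁻¹ p = mkTop (coeff≡c p) (λ i n<i → above≡0 p (suc i) (s<s n<i))

topCoeff-0 : ∀ {f n} → f ≈ 0ᵖ → TopCoeff f n 0ℤ
topCoeff-0 f≈0 = mkTop (coeff-≡ f≈0 _) (λ i _ → coeff-≡ f≈0 i)

-- Induction on `f`. At bound 0 the tail of `f` vanishes and only `a` times `g` remains. At a
-- successor bound that term lies below the top, so the top coefficient comes from the tail.
topCoeff-* : ∀ f {g m n c d} → TopCoeff f m c → TopCoeff g n d →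
             TopCoeff (f * g) (m ℕ.+ n) (c ℤ.* d)
topCoeff-* [] (mkTop refl _) _ = mkTop refl (λ _ _ → refl)
topCoeff-* (a ∷ f) {g} {zero} {n} {_} {d} (mkTop refl above) q =
  subst (TopCoeff ((a ∷ f) * g) n) (ℤ.+-identityʳ (a ℤ.* d))
    (topCoeff-+ (topCoeff-scale a q) (topCoeff-0 x*f*g≈0))
  where
  f≈0 : f ≈ 0ᵖ
  f≈0 = mk≈ λ i → above (suc i) z<s
  x*f*g≈0 : 0ℤ ∷ f * g ≈ 0ᵖ
  x*f*g≈0 = ≈-trans (∷-cong refl (*-cong f≈0 (≈-refl {g}))) 0∷0≈0
topCoeff-* (a ∷ f) {g} {suc m} {n} {c} {d} p q =
  subst (TopCoeff ((a ∷ f) * g) (suc m ℕ.+ n)) (ℤ.+-identityˡ (c ℤ.* d))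
    (topCoeff-+ (topCoeff-raise (s≤s (ℕ.m≤n+m n m)) (topCoeff-scale a q))
                (topCoeff-∷ 0ℤ (topCoeff-* f (topCoeff-∷⁻¹ p) q)))

-- Equivalent to Positive, but as a record it lets Agda infer f from a proof.
record Pos (f : Poly) : Set where
  constructor mkPos
  field
    {degree} : ℕ
    {lead}   : ℤ
    top      : TopCoeff f degree lead
    0<lead   : 0ℤ ℤ.< lead

Pos⇒Positive : ∀ {f} → Pos f → Positive f
Pos⇒Positive (mkPos (mkTop c≡ above) 0<c) =
  _ , (_ , c≡ , (λ c≡0 → ℤ.<⇒≢ 0<c (sym c≡0)) , above) , 0<c

Positive⇒Pos : ∀ {f} → Positive f → Pos f
Positive⇒Pos (_ , (_ , c≡ , _ , above) , 0<c) = mkPos (mkTop c≡ above) 0<c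

positive-resp : ∀ {f g} → f ≈ g → Pos f → Pos g
positive-resp f≈g (mkPos (mkTop c≡ above) 0<c) = mkPos
  (mkTop (trans (sym (coeff-≡ f≈g _)) c≡)
         (λ i n<i → trans (sym (coeff-≡ f≈g i)) (above i n<i)))
  0<c

positive⇒≉0 : ∀ {f} → Pos f → ¬ f ≈ 0ᵖ
positive⇒≉0 (mkPos (mkTop c≡ _) 0<c) f≈0 =
  ℤ.<⇒≢ 0<c (trans (sym (coeff-≡ f≈0 _)) c≡)

positive-+ : ∀ {f g} → Pos f → Pos g → Pos (f + g)
positive-+ (mkPos {m} {c} p 0<c) (mkPos {n} {d} q 0<d) with ℕ.<-cmp m n
... | tri< m<n _ _  = mkPos (topCoeff-+ (topCoeff-raise m<n p) q)
                            (subst (0ℤ ℤ.<_) (sym (ℤ.+-identityˡ d)) 0<d)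
... | tri≈ _ refl _ = mkPos (topCoeff-+ p q) (ℤ.+-mono-< 0<c 0<d)
... | tri> _ _ n<m  = mkPos (topCoeff-+ p (topCoeff-raise n<m q))
                            (subst (0ℤ ℤ.<_) (sym (ℤ.+-identityʳ c)) 0<c)

positive-* : ∀ {f g} → Pos f → Pos g → Pos (f * g)
positive-* {f} (mkPos {lead = c} p 0<c) (mkPos {lead = d} q 0<d) =
  mkPos (topCoeff-* f p q)
    (subst (ℤ._< c ℤ.* d) (ℤ.*-zeroʳ c) (ℤ.*-monoˡ-<-pos c ⦃ ℤ.positive 0<c ⦄ 0<d))

positive-tail : ∀ {a f} → Pos f → Pos (a ∷ f)
positive-tail (mkPos p 0<c) = mkPos (topCoeff-∷ _ p) 0<c

positive-head : ∀ {a f} → f ≈ 0ᵖ → 0ℤ ℤ.< a → Pos (a ∷ f)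
positive-head f≈0 = mkPos {degree = 0} (mkTop refl (λ { (suc i) _ → coeff-≡ f≈0 i }))

positive-∷⁻¹ : ∀ {a f} → Pos (a ∷ f) → Pos f ⊎ (f ≈ 0ᵖ × 0ℤ ℤ.< a)
positive-∷⁻¹ (mkPos {zero} (mkTop refl above) 0<a) =
  inj₂ (mk≈ (λ i → above (suc i) z<s) , 0<a)
positive-∷⁻¹ (mkPos {suc n} p 0<c) = inj₁ (mkPos (topCoeff-∷⁻¹ p) 0<c)

-- The tail decides the sign; the constant term matters only when the tail vanishes.
sign : ∀ f → f ≈ 0ᵖ ⊎ Pos f ⊎ Pos (- f)
sign [] = inj₁ ≈-refl
sign (a ∷ f) with sign f
... | inj₂ (inj₁ f>0)  = inj₂ (inj₁ (positive-tail f>0))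
... | inj₂ (inj₂ -f>0) = inj₂ (inj₂ (positive-tail -f>0))
... | inj₁ f≈0 with ℤ.<-cmp a 0ℤ
...   | tri< a<0 _ _ = inj₂ (inj₂ (positive-head (neg-cong f≈0) (ℤ.neg-mono-< a<0)))
...   | tri≈ _ a≡0 _ = inj₁ (≈-trans (∷-cong a≡0 f≈0) 0∷0≈0)
...   | tri> _ _ 0<a = inj₂ (inj₁ (positive-head f≈0 0<a))

-- Nonnegative polynomials

-- In the estimates below all slack terms may vanish; strictness comes from a single positive
-- summand, through `nonNegative+positive`.
data NonNegative (f : Poly) : Set where
  zero≥0 : f ≈ 0ᵖ → NonNegative f
  pos≥0  : Pos f → NonNegative f

nonNegative-resp : ∀ {f g} → f ≈ g → NonNegative f → NonNegative g
nonNegative-resp f≈g (zero≥0 f≈0) = zero≥0 (≈-trans (≈-sym f≈g) f≈0)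
nonNegative-resp f≈g (pos≥0 f>0)  = pos≥0 (positive-resp f≈g f>0)

nonNegative+positive : ∀ {f g} → NonNegative f → Pos g → Pos (f + g)
nonNegative+positive {f} {g} (zero≥0 f≈0) g>0 =
  positive-resp (+-congʳ g (≈-sym f≈0)) g>0
nonNegative+positive (pos≥0 f>0) g>0 = positive-+ f>0 g>0

nonNegative-+ : ∀ {f g} → NonNegative f → NonNegative g → NonNegative (f + g)
nonNegative-+ {f} {g} f≥0 (zero≥0 g≈0) =
  nonNegative-resp (≈-sym (≈-trans (+-congˡ f g≈0) (+-identityʳ f))) f≥0
nonNegative-+ f≥0 (pos≥0 g>0) = pos≥0 (nonNegative+positive f≥0 g>0)

positive*nonNegative : ∀ {f g} → Pos f → NonNegative g → NonNegative (f * g)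
positive*nonNegative {f} f>0 (zero≥0 g≈0) =
  zero≥0 (≈-trans (*-congˡ f g≈0) (*-zeroʳ f))
positive*nonNegative f>0 (pos≥0 g>0) = pos≥0 (positive-* f>0 g>0)

nonNegative-const : ∀ {a f} → 0ℤ ℤ.≤ a → f ≈ 0ᵖ → NonNegative (a ∷ f)
nonNegative-const {+ zero}  _ f≈0 = zero≥0 (≈-trans (∷-cong refl f≈0) 0∷0≈0)
nonNegative-const {+ suc _} _ f≈0 = pos≥0 (positive-head f≈0 (+<+ z<s))

-- The order is discrete: nothing lies strictly between 0 and 1. If the tail is positive, the change
-- of the constant term is invisible; otherwise this is the fact for integers.
nonNegative-pred : ∀ {a f} → Pos (a ∷ f) → NonNegative ((a ℤ.+ -1ℤ) ∷ f)
nonNegative-pred {a} a∷f>0 with positive-∷⁻¹ a∷f>0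
... | inj₁ f>0         = pos≥0 (positive-tail f>0)
... | inj₂ (f≈0 , 0<a) = nonNegative-const
  (ℤ.i≤j⇒0≤j-i (ℤ.i<j⇒suc[i]≤j 0<a)) f≈0

-- Gaps between digits

linear-positive : ∀ a → Pos (a ∷ 1ℤ ∷ [])
linear-positive a = positive-tail (positive-head ≈-refl (+<+ z<s))

digit-nonNegative : ∀ b → NonNegative (digitPoly b)
digit-nonNegative (num n)   = nonNegative-const (+≤+ z≤n) ≈-refl
digit-nonNegative (x-suc n) = pos≥0 (linear-positive -[1+ n ])

-- The right-hand side is bracketed as the constant coefficient of a difference of the form
-- `f - g - 1ᵖ` computes.
0≤j-i-1 : ∀ {i j} → i ℤ.< j → 0ℤ ℤ.≤ j ℤ.+ ℤ.- i ℤ.+ -1ℤ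
0≤j-i-1 {i} {j} i<j =
  subst (0ℤ ℤ.≤_) (lemma i j) (ℤ.i≤j⇒0≤j-i (ℤ.i<j⇒suc[i]≤j i<j))
  where
  lemma : ∀ i j → j ℤ.- (1ℤ ℤ.+ i) ≡ j ℤ.+ ℤ.- i ℤ.+ -1ℤ
  lemma = ℤSolver.solve-∀

digit-gap : ∀ {b c} → b <ᵈ c → NonNegative (digitPoly c - digitPoly b - 1ᵖ)
digit-gap (num<num m<n)     = nonNegative-const (0≤j-i-1 (+<+ m<n)) ≈-refl
-- The difference is monic of degree 1, hence positive whatever its constant term.
digit-gap num<x-suc         = pos≥0 (linear-positive _)
-- The two x cancel and leave a trailing zero, which `0∷0≈0` absorbs.
digit-gap (x-suc<x-suc n<m) = nonNegative-const (0≤j-i-1 (ℤ.-<- n<m)) 0∷0≈0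

xᵖ : Poly
xᵖ = 0ℤ ∷ 1ᵖ

-- The bound is sharp: the greatest digit x - 1 gives exactly 0.
digit<x : ∀ b → NonNegative (xᵖ - digitPoly b - 1ᵖ)
digit<x (num n)   = pos≥0 (linear-positive _)
digit<x (x-suc n) = nonNegative-const (0≤j-i-1 { -[1+ n ]} {0ℤ} ℤ.-<+) 0∷0≈0

num0<digit : ∀ {b} → b ≢ num 0 → num 0 <ᵈ b
num0<digit {num zero}    b≢0 = ⊥-elim (b≢0 refl)
num0<digit {num (suc n)} _   = num<num z<s
num0<digit {x-suc n}     _   = num<x-suc

-- Powers of x and values of digit strings

X^ : ℕ → Poly
X^ n = x^ n · 1ᵖ

-- Turns a shift into a product, so that the ring solver can treat the power as an atom.
x^-· : ∀ n f → x^ n · f ≈ X^ n * f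
x^-· zero    f = ≈-sym (*-identityˡ f)
x^-· (suc n) f = ≈-trans (∷-cong refl (x^-· n f)) (≈-sym (shift-* (X^ n) f))

x^-suc : ∀ n → X^ (suc n) ≈ xᵖ * X^ n
x^-suc n = ≈-sym (≈-trans (shift-* 1ᵖ (X^ n)) (∷-cong refl (*-identityˡ (X^ n))))

x^-positive : ∀ n → Pos (X^ n)
x^-positive zero    = positive-head ≈-refl (+<+ z<s)
x^-positive (suc n) = positive-tail (x^-positive n)

-- Each step from `X^ n` to `X^ (suc n)` adds `X^ n` times x - 1, which is positive.
x^-mono : ∀ {m n} → m ≤′ n → NonNegative (X^ n - X^ m)
x^-mono {m} (≤′-reflexive refl) = zero≥0 (+-inverseʳ (X^ m))
x^-mono {m} (≤′-step {n} m≤n) = nonNegative-resp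
  (begin
    X^ n * (xᵖ - 0ᵖ - 1ᵖ) + (X^ n - X^ m) ≈⟨ identity xᵖ (X^ n) (X^ m) ⟩
    xᵖ * X^ n - X^ m                      ≈⟨ +-congʳ (- X^ m) (x^-suc n) ⟨
    X^ (suc n) - X^ m                     ∎)
  (nonNegative-+ (positive*nonNegative (x^-positive n) (pos≥0 (linear-positive _)))
                 (x^-mono m≤n))
  where
  identity : ∀ x p q → p * (x - 0ᵖ - 1ᵖ) + (p - q) ≈ x * p - q
  identity = solve-∀ +-*-ring

value-∷ : ∀ b bs → value (b ∷ bs) ≈ X^ (length bs) * digitPoly b + value bs
value-∷ b bs = +-congʳ (value bs) (x^-· (length bs) (digitPoly b))

value-nonNegative : ∀ bs → NonNegative (value bs)
value-nonNegative []       = zero≥0 ≈-refl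
value-nonNegative (b ∷ bs) = nonNegative-resp (≈-sym (value-∷ b bs))
  (nonNegative-+ (positive*nonNegative (x^-positive (length bs)) (digit-nonNegative b))
                 (value-nonNegative bs))

-- By `digit<x` the leading digit leaves room for at least one more copy of its place value `p`, and
-- by induction the remaining digits stay below `p`.
value<x^length : ∀ bs → Pos (X^ (length bs) - value bs)
value<x^length []       = x^-positive 0
value<x^length (b ∷ bs) = positive-resp
  (begin
    p * (xᵖ - d - 1ᵖ) + (p - value bs) ≈⟨ identity xᵖ p d (value bs) ⟩
    xᵖ * p - (p * d + value bs)
      ≈⟨ +-cong (x^-suc (length bs)) (neg-cong (value-∷ b bs)) ⟨
    X^ (suc (length bs)) - value (b ∷ bs) ∎)
  (nonNegative+positive (positive*nonNegative (x^-positive (length bs)) (digit<x b))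
                        (value<x^length bs))
  where
  p = X^ (length bs)
  d = digitPoly b
  identity : ∀ x p d v → p * (x - d - 1ᵖ) + (p - v) ≈ x * p - (p * d + v)
  identity = solve-∀ +-*-ring

diff-trans : ∀ f g h → (h - g) + (g - f) ≈ h - f
diff-trans = solve-∀ +-*-ring

value<x^ : ∀ bs {n} → length bs ℕ.≤ n → Pos (X^ n - value bs)
value<x^ bs {n} len≤n = positive-resp
  (diff-trans (value bs) (X^ (length bs)) (X^ n))
  (nonNegative+positive (x^-mono (ℕ.≤⇒≤′ len≤n)) (value<x^length bs))

-- A nonzero leading digit is at least 1, so the longer string is worth at least `X^ (length cs)`,
-- which exceeds every string of at most `length cs` digits.
fewer⇒value< : ∀ {bs c cs} → c ≢ num 0 → length bs ℕ.≤ length cs →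
               Pos (value (c ∷ cs) - value bs)
fewer⇒value< {bs} {c} {cs} c≢0 len≤ = positive-resp
  (begin
    -- The digit 0 is the list `0ℤ ∷ []` and not `0ᵖ`, so the solver sees an atom `z`; the term
    -- `p * z` cancels it.
    (p * (d - z - 1ᵖ) + p * z + value cs) + (p - value bs)
      ≈⟨ identity p d z (value cs) (value bs) ⟩
    p * d + value cs - value bs
      ≈⟨ +-congʳ (- value bs) (value-∷ c cs) ⟨
    value (c ∷ cs) - value bs ∎)
  (nonNegative+positive
    (nonNegative-+
      (nonNegative-+ (positive*nonNegative p>0 (digit-gap (num0<digit c≢0)))
                     (positive*nonNegative p>0 (digit-nonNegative (num 0))))
      (value-nonNegative cs))
    (value<x^ bs len≤))
  where
  p = X^ (length cs)
  d = digitPoly c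
  z = digitPoly (num 0)
  p>0 = x^-positive (length cs)
  identity : ∀ p d z v w →
             (p * (d - z - 1ᵖ) + p * z + v) + (p - w) ≈ p * d + v - w
  identity = solve-∀ +-*-ring

-- Equal lengths give digits at the same position the same place value, and exclude the case of a
-- proper prefix. Common leading digits cancel. At the first difference the gap of at least 1
-- contributes `p`, which exceeds all that follows in `bs`.
lex⇒value< : ∀ {bs cs} → length bs ≡ length cs → Lex-< _≡_ _<ᵈ_ bs cs →
             Pos (value cs - value bs)
lex⇒value< {b ∷ bs} {c ∷ cs} len≡ (this b<c) = positive-resp
  (begin
    (p * (digitPoly c - digitPoly b - 1ᵖ) + value cs) + (p - value bs)
      ≈⟨ identity p (digitPoly c) (digitPoly b) (value cs) (value bs) ⟩
    p * digitPoly c + value cs - (p * digitPoly b + value bs)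
      ≡⟨ cong (λ n → p * digitPoly c + value cs - (X^ n * digitPoly b + value bs))
              (ℕ.suc-injective len≡) ⟨
    p * digitPoly c + value cs - (X^ (length bs) * digitPoly b + value bs)
      ≈⟨ +-cong (value-∷ c cs) (neg-cong (value-∷ b bs)) ⟨
    value (c ∷ cs) - value (b ∷ bs) ∎)
  (nonNegative+positive
    (nonNegative-+ (positive*nonNegative (x^-positive (length cs)) (digit-gap b<c))
                   (value-nonNegative cs))
    (value<x^ bs (ℕ.≤-reflexive (ℕ.suc-injective len≡))))
  where
  p = X^ (length cs)
  identity : ∀ p d e v w →
             (p * (d - e - 1ᵖ) + v) + (p - w) ≈ p * d + v - (p * e + w)
  identity = solve-∀ +-*-ring
lex⇒value< {b ∷ bs} {_ ∷ cs} len≡ (next refl bs<cs) = positive-resp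
  (begin
    value cs - value bs
      ≈⟨ identity t (value cs) (value bs) ⟩
    t + value cs - (t + value bs)
      ≡⟨ cong (λ n → t + value cs - (x^ n · digitPoly b + value bs))
              (ℕ.suc-injective len≡) ⟨
    value (b ∷ cs) - value (b ∷ bs) ∎)
  (lex⇒value< {bs} {cs} (ℕ.suc-injective len≡) bs<cs)
  where
  t = x^ length cs · digitPoly b
  identity : ∀ t v w → v - w ≈ t + v - (t + w)
  identity = solve-∀ +-*-ring

-‿cong : ∀ {f f′ g g′} → f ≈ f′ → g ≈ g′ → f - g ≈ f′ - g′
-‿cong f≈f′ g≈g′ = +-cong f≈f′ (neg-cong g≈g′)

≺⇒positive : ∀ {f g bs cs} → BaseXRep f bs → BaseXRep g cs → bs ≺ cs →
             Pos (g - f)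
≺⇒positive {bs = bs} {_ ∷ cs} (rep _ f≈) (rep c≢0 g≈) (fewer (s≤s len≤)) =
  positive-resp (-‿cong (≈-sym g≈) (≈-sym f≈)) (fewer⇒value< {bs} {cs = cs} c≢0 len≤)
≺⇒positive {bs = bs} {cs} (rep _ f≈) (rep _ g≈) (lex len≡ bs<cs) =
  positive-resp (-‿cong (≈-sym g≈) (≈-sym f≈)) (lex⇒value< {bs} {cs} len≡ bs<cs)

-- Existence of base-x representations

-- Horner's rule. `value` recurses from the most significant digit, while `hasRep` finds the least
-- significant digit first; this connects the two.
value-∷ʳ : ∀ bs b → value (bs ++ b ∷ []) ≈ (0ℤ ∷ value bs) + digitPoly b
value-∷ʳ []       b = begin
  digitPoly b + 0ᵖ        ≈⟨ +-comm (digitPoly b) 0ᵖ ⟩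
  digitPoly b             ≈⟨ +-congʳ (digitPoly b) 0∷0≈0 ⟨
  (0ℤ ∷ 0ᵖ) + digitPoly b ∎
value-∷ʳ (c ∷ bs) b = begin
  x^ length (bs ++ b ∷ []) · digitPoly c + value (bs ++ b ∷ [])
    ≡⟨ cong (λ n → x^ n · digitPoly c + value (bs ++ b ∷ []))
            (trans (length-++ bs) (ℕ.+-comm (length bs) 1)) ⟩
  (0ℤ ∷ x^ length bs · digitPoly c) + value (bs ++ b ∷ [])
    ≈⟨ +-congˡ (0ℤ ∷ x^ length bs · digitPoly c) (value-∷ʳ bs b) ⟩
  (0ℤ ∷ x^ length bs · digitPoly c) + ((0ℤ ∷ value bs) + digitPoly b)
    ≈⟨ +-assoc (0ℤ ∷ x^ length bs · digitPoly c) (0ℤ ∷ value bs) (digitPoly b) ⟨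
  (0ℤ ∷ value (c ∷ bs)) + digitPoly b ∎

rep-∷ʳ : ∀ {f g bs} b → g ≈ (0ℤ ∷ f) + digitPoly b → BaseXRep f bs →
         BaseXRep g (bs ++ b ∷ [])
rep-∷ʳ {f} {g} b g≈ (rep {c} {bs} c≢0 f≈) = rep c≢0 (begin
  g                                   ≈⟨ g≈ ⟩
  (0ℤ ∷ f) + digitPoly b              ≈⟨ +-congʳ (digitPoly b) (∷-cong refl f≈) ⟩
  (0ℤ ∷ value (c ∷ bs)) + digitPoly b ≈⟨ value-∷ʳ (c ∷ bs) b ⟨
  value ((c ∷ bs) ++ b ∷ [])          ∎)

hasRep-const : ∀ {a f} → f ≈ 0ᵖ → 0ℤ ℤ.< a → ∃[ bs ] BaseXRep (a ∷ f) bs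
hasRep-const {+ suc n} f≈0 _ = num (suc n) ∷ [] , rep (λ ()) (∷-cong refl f≈0)
hasRep-const {+ zero}  _ (+<+ ())

-- The last digit is read off the constant term; a negative constant term
-- -(n + 1) borrows x, which turns f = a + x f′ into x - (n + 1) + x (f′ - 1).
hasRep : ∀ a f → Pos (a ∷ f) → ∃[ bs ] BaseXRep (a ∷ f) bs
hasRep a f a∷f>0 with positive-∷⁻¹ a∷f>0
... | inj₂ (f≈0 , 0<a) = hasRep-const f≈0 0<a
hasRep a         []      _ | inj₁ 0>0 = ⊥-elim (positive⇒≉0 0>0 ≈-refl)
hasRep (+ n)     (c ∷ f) _ | inj₁ c∷f>0 with hasRep c f c∷f>0
... | bs , r = bs ++ num n ∷ [] , rep-∷ʳ (num n) ≈-refl r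
hasRep (-[1+ n ]) (c ∷ f) _ | inj₁ c∷f>0 with nonNegative-pred c∷f>0
-- Here the tail equals 1, and the borrow uses it up: a single digit remains.
... | zero≥0 c-1∷f≈0 = x-suc n ∷ [] , rep (λ ()) (∷-cong refl
  (∷-cong (ℤ.i-j≡0⇒i≡j c 1ℤ (coeff-≡ c-1∷f≈0 0)) (mk≈ λ i → coeff-≡ c-1∷f≈0 (suc i))))
-- Borrowing alters only the constant term of the tail. As that is a separate argument, the
-- recursion remains structural in the list.
... | pos≥0 c-1∷f>0 with hasRep (c ℤ.+ -1ℤ) f c-1∷f>0
...   | bs , r = bs ++ x-suc n ∷ [] ,
  rep-∷ʳ (x-suc n) (∷-cong refl (∷-cong (c≡c-1+1 c) (≈-sym (+-identityʳ f)))) r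
  where
  c≡c-1+1 : ∀ c → c ≡ c ℤ.+ -1ℤ ℤ.+ 1ℤ
  c≡c-1+1 = ℤSolver.solve-∀

positive⇒rep : ∀ {f} → Pos f → ∃[ bs ] BaseXRep f bs
positive⇒rep {[]}    0>0 = ⊥-elim (positive⇒≉0 0>0 ≈-refl)
positive⇒rep {a ∷ f} f>0 = hasRep a f f>0

rep-functional : ∀ {f g bs} → BaseXRep f bs → BaseXRep g bs → f ≈ g
rep-functional (rep _ f≈) (rep _ g≈) = ≈-trans f≈ (≈-sym g≈)

-- Comparison of digit strings

<ᵈ-compare : Trichotomous _≡_ _<ᵈ_
<ᵈ-compare (num m) (x-suc n) = tri< num<x-suc (λ ()) (λ ())
<ᵈ-compare (x-suc m) (num n) = tri> (λ ()) (λ ()) num<x-suc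
<ᵈ-compare (num m) (num n) with ℕ.<-cmp m n
... | tri< m<n m≢n m≯n =
  tri< (num<num m<n) (λ { refl → m≢n refl }) (λ { (num<num n<m) → m≯n n<m })
... | tri≈ m≮n refl m≯n =
  tri≈ (λ { (num<num m<n) → m≮n m<n }) refl (λ { (num<num n<m) → m≯n n<m })
... | tri> m≮n m≢n n<m =
  tri> (λ { (num<num m<n) → m≮n m<n }) (λ { refl → m≢n refl }) (num<num n<m)
<ᵈ-compare (x-suc m) (x-suc n) with ℕ.<-cmp m n
... | tri< m<n m≢n m≯n =
  tri> (λ { (x-suc<x-suc n<m) → m≯n n<m }) (λ { refl → m≢n refl }) (x-suc<x-suc m<n)
... | tri≈ m≮n refl m≯n =
  tri≈ (λ { (x-suc<x-suc n<m) → m≯n n<m }) refl (λ { (x-suc<x-suc m<n) → m≮n m<n })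
... | tri> m≮n m≢n n<m =
  tri< (x-suc<x-suc n<m) (λ { refl → m≢n refl }) (λ { (x-suc<x-suc m<n) → m≮n m<n })

≺-total : ∀ bs cs → bs ≺ cs ⊎ bs ≡ cs ⊎ cs ≺ bs
≺-total bs cs with ℕ.<-cmp (length bs) (length cs)
... | tri< len< _ _ = inj₁ (fewer len<)
... | tri> _ _ len> = inj₂ (inj₂ (fewer len>))
... | tri≈ _ len≡ _ with <-compare sym <ᵈ-compare bs cs
...   | tri< bs<cs _ _ = inj₁ (lex len≡ bs<cs)
...   | tri≈ _ bs≋cs _ = inj₂ (inj₁ (Pointwise-≡⇒≡ bs≋cs))
...   | tri> _ _ cs<bs = inj₂ (inj₂ (lex (sym len≡) cs<bs))

-- The digit order as positivity of the difference

f-g≈0⇒f≈g : ∀ {f g} → f - g ≈ 0ᵖ → f ≈ g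
f-g≈0⇒f≈g {f} {g} f-g≈0 = ≈-trans (identity f g) (+-congʳ g f-g≈0)
  where
  identity : ∀ f g → f ≈ (f - g) + g
  identity = solve-∀ +-*-ring

f≈g⇒f-g≈0 : ∀ {f g} → f ≈ g → f - g ≈ 0ᵖ
f≈g⇒f-g≈0 {f} {g} f≈g = ≈-trans (+-congʳ (- g) f≈g) (+-inverseʳ g)

neg-diff : ∀ f g → - f - - g ≈ g - f
neg-diff = solve-∀ +-*-ring

neg-of-diff : ∀ f g → - (f - g) ≈ g - f
neg-of-diff = solve-∀ +-*-ring

positive-asym : ∀ {f} → Pos f → ¬ Pos (- f)
positive-asym {f} f>0 -f>0 = positive⇒≉0 (positive-+ f>0 -f>0) (+-inverseʳ f)

diff-asym : ∀ f g → Pos (g - f) → ¬ Pos (f - g)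
diff-asym f g g-f>0 f-g>0 =
  positive-asym g-f>0 (positive-resp (≈-sym (neg-of-diff g f)) f-g>0)

<⇒positive : ∀ {f g} → f < g → Pos (g - f)
<⇒positive (pos<pos _ _ f-rep g-rep bs≺cs) = ≺⇒positive f-rep g-rep bs≺cs
<⇒positive {f} {g} (zero<pos f≈0 g>0) =
  positive-resp (≈-sym (≈-trans (+-congˡ g (neg-cong f≈0)) (+-identityʳ g)))
                (Positive⇒Pos g>0)
<⇒positive {f} {g} (neg<zero -f>0 g≈0) =
  positive-resp (+-congʳ (- f) (≈-sym g≈0)) (Positive⇒Pos -f>0)
<⇒positive {f} {g} (neg<pos -f>0 g>0) =
  positive-+ (Positive⇒Pos {g} g>0) (Positive⇒Pos { - f} -f>0)
<⇒positive {f} {g} (neg<neg _ _ -g<-f) =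
  positive-resp (neg-diff f g) (<⇒positive -g<-f)

-- Digit strings are comparable, and the other two outcomes would make `g - f` zero or its negative
-- positive.
positive⇒pos<pos : ∀ {f g} → Pos f → Pos g → Pos (g - f) → f < g
positive⇒pos<pos {f} {g} f>0 g>0 g-f>0 with positive⇒rep f>0 | positive⇒rep g>0
... | bs , f-rep | cs , g-rep with ≺-total bs cs
...   | inj₁ bs≺cs        = pos<pos (Pos⇒Positive f>0) (Pos⇒Positive g>0) f-rep g-rep bs≺cs
...   | inj₂ (inj₁ refl)  =
          ⊥-elim (positive⇒≉0 g-f>0 (f≈g⇒f-g≈0 (rep-functional g-rep f-rep)))
...   | inj₂ (inj₂ cs≺bs) = ⊥-elim (diff-asym f g g-f>0 (≺⇒positive g-rep f-rep cs≺bs))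

-- Each possible pair of signs matches one constructor. In the impossible ones, either both
-- polynomials vanish or the reverse inequality holds and `<⇒positive` refutes it.
positive⇒< : ∀ {f g} → Pos (g - f) → f < g
positive⇒< {f} {g} g-f>0 with sign f | sign g
... | inj₁ f≈0         | inj₂ (inj₁ g>0)  = zero<pos f≈0 (Pos⇒Positive g>0)
... | inj₂ (inj₂ -f>0) | inj₁ g≈0         = neg<zero (Pos⇒Positive -f>0) g≈0
... | inj₂ (inj₂ -f>0) | inj₂ (inj₁ g>0)  = neg<pos (Pos⇒Positive -f>0) (Pos⇒Positive g>0)
... | inj₂ (inj₁ f>0)  | inj₂ (inj₁ g>0)  = positive⇒pos<pos f>0 g>0 g-f>0
... | inj₂ (inj₂ -f>0) | inj₂ (inj₂ -g>0) =
  neg<neg (Pos⇒Positive -f>0) (Pos⇒Positive -g>0)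
    (positive⇒pos<pos -g>0 -f>0 (positive-resp (≈-sym (neg-diff f g)) g-f>0))
... | inj₁ f≈0         | inj₁ g≈0         =
  ⊥-elim (positive⇒≉0 g-f>0 (f≈g⇒f-g≈0 (≈-trans g≈0 (≈-sym f≈0))))
... | inj₁ f≈0         | inj₂ (inj₂ -g>0) =
  ⊥-elim (diff-asym f g g-f>0 (<⇒positive (neg<zero (Pos⇒Positive -g>0) f≈0)))
... | inj₂ (inj₁ f>0)  | inj₁ g≈0         =
  ⊥-elim (diff-asym f g g-f>0 (<⇒positive (zero<pos g≈0 (Pos⇒Positive f>0))))
... | inj₂ (inj₁ f>0)  | inj₂ (inj₂ -g>0) =
  ⊥-elim (diff-asym f g g-f>0
    (<⇒positive {g} {f} (neg<pos (Pos⇒Positive -g>0) (Pos⇒Positive f>0))))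

-- The strict total order

<-trans : ∀ {f g h} → f < g → g < h → f < h
<-trans {f} {g} {h} f<g g<h = positive⇒<
  (positive-resp (diff-trans f g h) (positive-+ (<⇒positive g<h) (<⇒positive f<g)))

<-irrefl : ∀ {f g} → f ≈ g → ¬ f < g
<-irrefl f≈g f<g = positive⇒≉0 (<⇒positive f<g) (f≈g⇒f-g≈0 (≈-sym f≈g))

<-asym : ∀ {f g} → f < g → ¬ g < f
<-asym {f} {g} f<g g<f = diff-asym f g (<⇒positive f<g) (<⇒positive g<f)

<-resp : ∀ {f f′ g g′} → f ≈ f′ → g ≈ g′ → f < g → f′ < g′
<-resp f≈f′ g≈g′ f<g = positive⇒< (positive-resp (-‿cong g≈g′ f≈f′) (<⇒positive f<g))

<-cmp : Trichotomous _≈_ _<_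
<-cmp f g with sign (f - g)
... | inj₁ f-g≈0        =
  let f≈g = f-g≈0⇒f≈g f-g≈0 in tri≈ (<-irrefl f≈g) f≈g (<-irrefl (≈-sym f≈g))
... | inj₂ (inj₁ f-g>0) =
  let g<f = positive⇒< f-g>0
  in tri> (<-asym g<f) (λ f≈g → <-irrefl (≈-sym f≈g) g<f) g<f
... | inj₂ (inj₂ g-f>0) =
  let f<g = positive⇒< (positive-resp (neg-of-diff f g) g-f>0)
  in tri< f<g (λ f≈g → <-irrefl f≈g f<g) (<-asym f<g)

<-isStrictTotalOrder : IsStrictTotalOrder _≈_ _<_
<-isStrictTotalOrder = record
  { isStrictPartialOrder = record
    { isEquivalence = ≈-isEquivalence
    ; irrefl        = <-irrefl
    ; trans         = <-trans
    ; <-resp-≈      = <-resp ≈-refl , λ f≈f′ → <-resp f≈f′ ≈-refl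
    }
  ; compare = <-cmp
  }

-- Compatibility with the ring operations

+-monoˡ-< : ∀ f g h → f < g → f + h < g + h
+-monoˡ-< f g h f<g = positive⇒< (positive-resp (identity f g h) (<⇒positive f<g))
  where
  identity : ∀ f g h → g - f ≈ (g + h) - (f + h)
  identity = solve-∀ +-*-ring

0<⇒positive : ∀ {f} → 0ᵖ < f → Pos f
0<⇒positive {f} 0<f = positive-resp (+-identityʳ f) (<⇒positive 0<f)

*-monoˡ-< : ∀ f g h → 0ᵖ < h → f < g → f * h < g * h
*-monoˡ-< f g h 0<h f<g = positive⇒<
  (positive-resp (identity f g h) (positive-* (<⇒positive f<g) (0<⇒positive 0<h)))
  where
  identity : ∀ f g h → (g - f) * h ≈ g * h - f * h
  identity = solve-∀ +-*-ring

*-negʳ : ∀ f g → f * - g ≈ - (f * g)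
*-negʳ = solve-∀ +-*-ring

*-negˡ : ∀ f g → - f * g ≈ - (f * g)
*-negˡ = solve-∀ +-*-ring

neg-*-neg : ∀ f g → - f * - g ≈ f * g
neg-*-neg = solve-∀ +-*-ring

-- A nonzero polynomial is positive up to sign, and a product of positive polynomials is positive,
-- hence nonzero.
noZeroDivisors : ∀ f g → f * g ≈ 0ᵖ → f ≈ 0ᵖ ⊎ g ≈ 0ᵖ
noZeroDivisors f g fg≈0 with sign f | sign g
... | inj₁ f≈0         | _                = inj₁ f≈0
... | inj₂ _           | inj₁ g≈0         = inj₂ g≈0
... | inj₂ (inj₁ f>0)  | inj₂ (inj₁ g>0)  =
  ⊥-elim (positive⇒≉0 (positive-* f>0 g>0) fg≈0)
... | inj₂ (inj₁ f>0)  | inj₂ (inj₂ -g>0) =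
  ⊥-elim (positive⇒≉0 (positive-* f>0 -g>0) (≈-trans (*-negʳ f g) (neg-cong fg≈0)))
... | inj₂ (inj₂ -f>0) | inj₂ (inj₁ g>0)  =
  ⊥-elim (positive⇒≉0 (positive-* -f>0 g>0) (≈-trans (*-negˡ f g) (neg-cong fg≈0)))
... | inj₂ (inj₂ -f>0) | inj₂ (inj₂ -g>0) =
  ⊥-elim (positive⇒≉0 (positive-* -f>0 -g>0) (≈-trans (neg-*-neg f g) fg≈0))

corollary1 : IsOrderedIntegralDomain _≈_ _<_ _+_ _*_ -_ 0ᵖ 1ᵖ
    × (∀ f g → f > g ⇔ Positive (f - g))
    × (∀ f g → f > g → (∀ h → f + h > g + h) × (∀ h → h > 0ᵖ → f * h > g * h))
corollary1 =
  record
    { isIntegralDomain = record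
      { isCommutativeRing = +-*-isCommutativeRing
      -- `X^ 0` computes to `1ᵖ`.
      ; 1≉0               = positive⇒≉0 (x^-positive 0)
      ; noZeroDivisors    = noZeroDivisors
      }
    ; isStrictTotalOrder = <-isStrictTotalOrder
    ; +-monoˡ-<          = +-monoˡ-<
    -- Monotonicity applied to 0 < f suffices, since `0ᵖ * g` computes to `0ᵖ`.
    ; *-positive         = λ f g 0<f 0<g → *-monoˡ-< 0ᵖ f g 0<g 0<f
    } ,
  (λ f g → mk⇔ (Pos⇒Positive ∘ <⇒positive) (positive⇒< ∘ Positive⇒Pos)) ,
  (λ f g g<f → (λ h → +-monoˡ-< g f h g<f) , (λ h 0<h → *-monoˡ-< g f h 0<h g<f))
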